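{- Let $G$ be a finite simple graph and $r\ge 2$. Then there exists an AON minimum $r$-fold PSD forcing set for $G$. For every $r\ge 3$, exactly one cluster of $G^{(r)}$ is forced at each step of any forcing process that begins with any AON minimum $r$-fold PSD forcing set. For $r=2$, there exists an AON minimum $2$-fold PSD forcing set for $G$ together with a forcing process starting from it in which exactly one cluster of $G^{(2)}$ is forced at each step.
   Context: For $r\in\mathbb{N}$, the $r$-blowup $G^{(r)}$ is obtained by replacing each vertex $u$ of $G$ by an independent set $R_u$ of $r$ vertices (a cluster) and each edge $uw$ by all edges between $R_u$ and $R_w$. $r$-fold PSD forcing game: an initial set $B\subseteq V(G^{(r)})$ is blue, the rest white. A forcing process is a sequence of steps. In an ordinary step, with $B_t$ the current blue set and $W_1,\dots,W_h$ the vertex sets of the connected components of $G^{(r)}-B_t$, a vertex $u\in B_t$ with $|N(u)\cap W_i|\le r$ for some $i$ forces $N(u)\cap W_i$, i.e. colors all of these vertices blue. Forcing processes may also use backforcing steps: if a vertex of a cluster $R_u$ that is not entirely blue has just performed a force, then at the next step all vertices of $R_u$ may be colored blue. $B$ is an $r$-fold PSD forcing set if some forcing process makes all of $G^{(r)}$ blue; it is minimum if it has the minimum cardinality among such sets. A cluster is forced at a step if some of its vertices turn from white to blue at that step. Relative to a coloring of $G^{(r)}$, a cluster is an All cluster if all its vertices are blue, a One cluster if exactly one of its vertices is blue, and a None cluster if all its vertices are white. An AON $r$-fold PSD forcing set is an $r$-fold PSD forcing set $B$ such that, when $G^{(r)}$ is colored with $B$, every cluster is an All, One, or None cluster. -}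

module Defs where

open import Data.Nat using (ℕ; zero; suc; _+_; _≤_)
open import Data.Fin using (Fin; _≟_)
open import Data.Fin.Properties using () 
open import Data.Bool using (Bool; true; false; _∨_; if_then_else_)
open import Data.Product using (Σ; ∃; ∃-syntax; _×_; _,_; proj₁; proj₂)
open import Data.Sum using (_⊎_)
open import Data.Maybe using (Maybe; just; nothing)
open import Data.List using (List; length; map; allFin)
open import Data.Nat.ListAction using (sum)
open import Data.List.Membership.Propositional using (_∈_)
open import Data.List.Relation.Unary.Unique.Propositional using (Unique)
open import Relation.Binary.PropositionalEquality using (_≡_)
open import Relation.Nullary using (¬_)
open import Relation.Nullary.Decidable using (⌊_⌋)
open import Function.Bundles using (_⇔_)

record SimpleGraph (n : ℕ) : Set where
  field
    adj     : Fin n → Fin n → Bool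
    adj-sym : ∀ u w → adj u w ≡ adj w u
    irrefl  : ∀ u → adj u u ≡ false
open SimpleGraph public

module _ {n : ℕ} (G : SimpleGraph n) (r : ℕ) where

  -- Vertices of the r-blowup G^(r): vertex (u , i) is the i-th vertex
  -- of the cluster R_u.
  BVert : Set
  BVert = Fin n × Fin r

  BAdj : BVert → BVert → Set
  BAdj x y = adj G (proj₁ x) (proj₁ y) ≡ true

  Coloring : Set
  Coloring = BVert → Bool

  Blue White : Coloring → BVert → Set
  Blue  C x = C x ≡ true
  White C x = C x ≡ false

  count : Coloring → ℕ
  count C = sum (map (λ u → sum (map (λ i → if C (u , i) then 1 else 0) (allFin r))) (allFin n))

  data Reach (C : Coloring) (x : BVert) : BVert → Set where
    here : White C x → Reach C x x
    step : ∀ {y z} → Reach C x y → BAdj y z → White C z → Reach C x z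

  NbrInComp : Coloring → BVert → BVert → BVert → Set
  NbrInComp C v x y = BAdj v y × Reach C x y

  AtMost : ℕ → (BVert → Set) → Set
  AtMost k S = ∃[ L ] (Unique L × (∀ y → S y → y ∈ L) × length L ≤ k)

  OrdForce : Coloring → BVert → Coloring → Set
  OrdForce C v C' =
    Blue C v ×
    (∃[ x ] ( AtMost r (NbrInComp C v x)
            × (∃[ y ] NbrInComp C v x y)
            × (∀ y → (Blue C' y ⇔ (Blue C y ⊎ NbrInComp C v x y)))))

  addCluster : Coloring → BVert → Coloring
  addCluster C v y = C y ∨ ⌊ proj₁ y ≟ proj₁ v ⌋

  AllBlueCluster : Coloring → Fin n → Set
  AllBlueCluster C u = ∀ i → Blue C (u , i)

  -- A forcing process starting from B, currently at coloring C.
  -- The Maybe index records the vertex that performed the last step if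
  -- that step was an ordinary force (needed for backforcing).
  data Proc (B : Coloring) : Maybe BVert → Coloring → Set where
    start : Proc B nothing B
    force : ∀ {m C C'} v → Proc B m C → OrdForce C v C' → Proc B (just v) C'
    back  : ∀ {C} v → Proc B (just v) C → ¬ AllBlueCluster C (proj₁ v)
          → Proc B nothing (addCluster C v)

  ClusterForced : Coloring → Coloring → Fin n → Set
  ClusterForced C C' u = ∃[ i ] (White C (u , i) × Blue C' (u , i))

  ExactlyOneClusterForced : Coloring → Coloring → Set
  ExactlyOneClusterForced C C' =
    ∃[ u ] (ClusterForced C C' u × (∀ w → ClusterForced C C' w → w ≡ u))

  EachStepOneCluster : ∀ {B m C} → Proc B m C → Set
  EachStepOneCluster start = Data.Unit.⊤
    where import Data.Unit
  EachStepOneCluster (force {C = C} {C' = C'} v p _) =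
    EachStepOneCluster p × ExactlyOneClusterForced C C'
  EachStepOneCluster (back {C = C} v p _) =
    EachStepOneCluster p × ExactlyOneClusterForced C (addCluster C v)

  AllBlue : Coloring → Set
  AllBlue C = ∀ x → Blue C x

  IsForcingSet : Coloring → Set
  IsForcingSet B = ∃[ m ] ∃[ C ] (Proc B m C × AllBlue C)

  IsMinForcingSet : Coloring → Set
  IsMinForcingSet B = IsForcingSet B × (∀ B' → IsForcingSet B' → count B ≤ count B')

  AllCluster OneCluster NoneCluster : Coloring → Fin n → Set
  AllCluster C u = ∀ i → Blue C (u , i)
  OneCluster C u = ∃[ i ] (Blue C (u , i) × (∀ j → Blue C (u , j) → j ≡ i))
  NoneCluster C u = ∀ i → White C (u , i)

  IsAON : Coloring → Set
  IsAON B = ∀ u → AllCluster B u ⊎ OneCluster B u ⊎ NoneCluster B u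

  IsAONMinForcingSet : Coloring → Set
  IsAONMinForcingSet B = IsMinForcingSet B × IsAON B

{-# OPTIONS --safe #-}

-- Everything reduces to a game on the clusters, marked ALL, ONE or NONE, in which a cluster that
-- is not NONE forces its only neighbour that is not ALL in some component, and then becomes ALL
-- by backforcing.  Each move is realised in the blowup by steps forcing a single cluster.
-- Conversely, a forcing process from any set B yields a winning initial marking of no larger
-- cost: a cluster that forces before it is forced is marked ONE, and of the clusters forced for
-- the first time in one step one is marked NONE and the others ALL.  The game is monotone, hence
-- decidable, so a cheapest winning marking exists; it is an AON minimum forcing set.
-- For r ≥ 3, a step forcing two clusters of an AON coloring would need 2 (r - 1) > r vertices.
module Submission where

open import Defs
open import Data.Bool using (Bool; true; false; not; _∧_; _∨_; if_then_else_)
open import Data.Bool.Properties using (¬-not)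
import Data.Bool.Properties as Bool
open import Data.Empty using (⊥; ⊥-elim)
open import Data.Fin using (Fin; zero; suc; toℕ; fromℕ<; _≟_)
open import Data.Fin.Properties using (any?; all?; ¬∀⟶∃¬; sequence; toℕ-fromℕ<)
open import Data.Fin.Subset.Properties using (anySubset?)
open import Data.List using (List; []; _∷_; _++_; map; allFin; length; cartesianProduct)
open import Data.List.Membership.Propositional using (_∈_)
open import Data.List.Membership.Propositional.Properties
  using (∈-∃++; ∈-++⁺ˡ; ∈-++⁺ʳ; ∈-++⁻; ∈-allFin; ∈-map⁺)
open import Data.List.Properties
  using (length-++-sucʳ; length-map; length-tabulate; map-++; map-∘; map-cong)
import Data.List.Relation.Unary.All as All
open import Data.List.Relation.Unary.AllPairs using ([]; _∷_)
open import Data.List.Relation.Unary.Any using (here; there)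
open import Data.List.Relation.Unary.Unique.Propositional using (Unique)
import Data.List.Relation.Unary.Unique.Propositional.Properties as Unique
open import Data.Maybe using (Maybe; just; nothing; maybe′; fromMaybe; _<∣>_)
open import Data.Nat using (ℕ; zero; suc; _+_; _≤_; _<_; _<?_; z≤n; s≤s)
open import Data.Nat.ListAction using (sum)
open import Data.Nat.ListAction.Properties using (sum-++)
open import Data.Nat.Induction using (<-wellFounded)
open import Data.Nat.Properties
  using (+-mono-≤; +-monoˡ-≤; +-monoʳ-≤; +-comm; +-suc; +-identityʳ; ≤-refl; ≤-trans;
         ≤-reflexive; m≤m+n; m≤n+m; +-cancelʳ-≤; ≮⇒≥; <⇒≱; module ≤-Reasoning)
open import Data.Nat.Solver using (module +-*-Solver)
open import Data.Product using (∃; ∃-syntax; _×_; _,_; proj₁; proj₂)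
open import Data.Product.Properties using (≡-dec)
open import Data.Sum using (_⊎_; inj₁; inj₂)
open import Data.Vec using (lookup; tabulate)
open import Data.Vec.Properties using (lookup∘tabulate)
open import Effect.Monad using (RawMonad)
open import Function using (_∘_; case_of_)
open import Function.Bundles using (Equivalence; mk⇔)
open import Induction.WellFounded using (Acc; acc)
open import Relation.Binary.PropositionalEquality
  using (_≡_; _≢_; refl; sym; trans; cong; cong₂; subst)
open import Relation.Nullary using (¬_; Dec; yes; no; contradiction)
open import Relation.Nullary.Decidable
  using (⌊_⌋; map′; _×-dec_; _→-dec_; ¬?; decidable-stable; ¬¬-excluded-middle)
open import Relation.Nullary.Negation using (¬¬-Monad)

-- Finite sums and counting.

∑ : ∀ {n} → (Fin n → ℕ) → ℕ
∑ {n} f = sum (map f (allFin n))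

indicator : Bool → ℕ
indicator b = if b then 1 else 0

≟-refl : ∀ {n} (u : Fin n) → ⌊ u ≟ u ⌋ ≡ true
≟-refl u with u ≟ u
... | yes _  = refl
... | no u≢u = contradiction refl u≢u

≟-≢ : ∀ {n} {w u : Fin n} → w ≢ u → ⌊ w ≟ u ⌋ ≡ false
≟-≢ {w = w} {u} w≢u with w ≟ u
... | yes w≡u = contradiction w≡u w≢u
... | no _    = refl

-- Places a constant added to a whole sum at one index, so that the inequality can be checked
-- pointwise.
δ : ∀ {n} → Fin n → ℕ → Fin n → ℕ
δ u k w = if ⌊ w ≟ u ⌋ then k else 0

module _ {a} {A : Set a} where

  sum-map-mono : ∀ {f g : A → ℕ} (xs : List A) → (∀ x → f x ≤ g x) →
                 sum (map f xs) ≤ sum (map g xs)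
  sum-map-mono []       f≤g = z≤n
  sum-map-mono (x ∷ xs) f≤g = +-mono-≤ (f≤g x) (sum-map-mono xs f≤g)

  sum-map-+ : ∀ (f g : A → ℕ) (xs : List A) →
              sum (map (λ x → f x + g x) xs) ≡ sum (map f xs) + sum (map g xs)
  sum-map-+ f g []       = refl
  sum-map-+ f g (x ∷ xs) = trans (cong (f x + g x +_) (sum-map-+ f g xs))
    (solve 4 (λ a b c d → (a :+ b) :+ (c :+ d) := (a :+ c) :+ (b :+ d)) refl
       (f x) (g x) (sum (map f xs)) (sum (map g xs)))
    where open +-*-Solver

  ∈⇒≤sum-map : ∀ (f : A → ℕ) {x xs} → x ∈ xs → f x ≤ sum (map f xs)
  ∈⇒≤sum-map f (here refl)       = m≤m+n _ _
  ∈⇒≤sum-map f (there {x} x∈xs) = ≤-trans (∈⇒≤sum-map f x∈xs) (m≤n+m _ (f x))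

  sum-map-1 : (xs : List A) → sum (map (λ _ → 1) xs) ≡ length xs
  sum-map-1 []       = refl
  sum-map-1 (_ ∷ xs) = cong suc (sum-map-1 xs)

  -- Each true entry uses up one occurrence of itself in `L`. Later entries differ from it because
  -- `xs` has no repetitions, so the shortened list still covers them.
  sum-indicator≤ : ∀ (F : A → Bool) {xs} L → Unique xs →
                   (∀ x → x ∈ xs → F x ≡ true → x ∈ L) →
                   sum (map (λ x → indicator (F x)) xs) ≤ length L
  sum-indicator≤ F L [] cover = z≤n
  sum-indicator≤ F {x ∷ xs} L (x∉xs ∷ uniq) cover with F x in Fx
  ... | false = sum-indicator≤ F L uniq λ y y∈ → cover y (there y∈)
  ... | true with ∈-∃++ (cover x (here refl) Fx)
  ... | ys , zs , refl = ≤-trans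
    (s≤s (sum-indicator≤ F (ys ++ zs) uniq λ y y∈ Fy →
            delete y (λ { refl → All.lookup x∉xs y∈ refl }) (cover y (there y∈) Fy)))
    (≤-reflexive (sym (length-++-sucʳ ys x zs)))
    where
    delete : ∀ y → y ≢ x → y ∈ ys ++ x ∷ zs → y ∈ ys ++ zs
    delete y y≢x y∈ with ∈-++⁻ ys y∈
    ... | inj₁ y∈ys         = ∈-++⁺ˡ y∈ys
    ... | inj₂ (here y≡x)   = contradiction y≡x y≢x
    ... | inj₂ (there y∈zs) = ∈-++⁺ʳ ys y∈zs

∑-mono : ∀ {n} {f g : Fin n → ℕ} → (∀ u → f u ≤ g u) → ∑ f ≤ ∑ g
∑-mono = sum-map-mono (allFin _)

∑-+ : ∀ {n} (f g : Fin n → ℕ) → ∑ (λ u → f u + g u) ≡ ∑ f + ∑ g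
∑-+ f g = sum-map-+ f g (allFin _)

∑-1 : ∀ {n} → ∑ {n} (λ _ → 1) ≡ n
∑-1 {n} = trans (sum-map-1 (allFin n)) (length-tabulate {n = n} (λ i → i))

δ-diag : ∀ {n} (u : Fin n) k → δ u k u ≡ k
δ-diag u k rewrite ≟-refl u = refl

∑-bump : ∀ {n} {f g : Fin n → ℕ} u {k} → (∀ w → f w + δ u k w ≤ g w) → ∑ f + k ≤ ∑ g
∑-bump {f = f} {g} u {k} f+δ≤g = begin
  ∑ f + k                  ≡⟨ cong (∑ f +_) (δ-diag u k) ⟨
  ∑ f + δ u k u            ≤⟨ +-monoʳ-≤ (∑ f) (∈⇒≤sum-map (δ u k) (∈-allFin u)) ⟩
  ∑ f + ∑ (δ u k)          ≡⟨ ∑-+ f (δ u k) ⟨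
  ∑ (λ w → f w + δ u k w)  ≤⟨ ∑-mono f+δ≤g ⟩
  ∑ g                      ∎
  where open ≤-Reasoning

∑-strict : ∀ {n} {f g : Fin n → ℕ} u → (∀ w → f w ≤ g w) → f u < g u → ∑ f < ∑ g
∑-strict {f = f} {g} u f≤g fu<gu = subst (_≤ ∑ g) (+-comm (∑ f) 1) (∑-bump u bump)
  where
  bump : ∀ w → f w + δ u 1 w ≤ g w
  bump w with w ≟ u
  ... | yes refl = subst (_≤ g w) (+-comm 1 (f w)) fu<gu
  ... | no _     = subst (_≤ g w) (sym (+-identityʳ (f w))) (f≤g w)

∑-two : ∀ {n} (f : Fin n → ℕ) {u v} → u ≢ v → f u + f v ≤ ∑ f
∑-two f {u} {v} u≢v = begin
  f u + f v              ≡⟨ cong (_+ f v) (δ-diag u (f u)) ⟨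
  δ u (f u) u + f v      ≤⟨ +-monoˡ-≤ (f v) (∈⇒≤sum-map (δ u (f u)) (∈-allFin u)) ⟩
  ∑ (δ u (f u)) + f v    ≤⟨ ∑-bump v both ⟩
  ∑ f                    ∎
  where
  open ≤-Reasoning
  both : ∀ w → δ u (f u) w + δ v (f v) w ≤ f w
  both w with w ≟ u | w ≟ v
  ... | yes refl | yes refl = contradiction refl u≢v
  ... | yes refl | no _     = ≤-reflexive (+-identityʳ _)
  ... | no _     | yes refl = ≤-refl
  ... | no _     | no _     = z≤n

-- Flattened over the cartesian product, which has no repetitions, the double sum falls under
-- `sum-indicator≤`.
∑∑-indicator≤ : ∀ {m k} (F : Fin m × Fin k → Bool) L → (∀ x → F x ≡ true → x ∈ L) →
                ∑ (λ u → ∑ (λ i → indicator (F (u , i)))) ≤ length L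
∑∑-indicator≤ {m} {k} F L cover = begin
  ∑ (λ u → ∑ (λ i → indicator (F (u , i))))
    ≡⟨ double (allFin m) ⟨
  sum (map (indicator ∘ F) (cartesianProduct (allFin m) (allFin k)))
    ≤⟨ sum-indicator≤ F L (Unique.cartesianProduct⁺ (Unique.allFin⁺ m) (Unique.allFin⁺ k))
         (λ x _ → cover x) ⟩
  length L ∎
  where
  open ≤-Reasoning
  double : ∀ us → sum (map (indicator ∘ F) (cartesianProduct us (allFin k)))
                ≡ sum (map (λ u → ∑ (λ i → indicator (F (u , i)))) us)
  double []       = refl
  double (u ∷ us) =
    trans (cong sum (map-++ (indicator ∘ F) (map (u ,_) (allFin k)) _))
    (trans (sum-++ (map (indicator ∘ F) (map (u ,_) (allFin k))) _)
      (cong₂ _+_ (cong sum (sym (map-∘ (allFin k)))) (double us)))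

-- Marks of clusters and search over markings.

data Mark : Set where
  ALL ONE NONE : Mark

_≟ᴹ_ : (c d : Mark) → Dec (c ≡ d)
ALL  ≟ᴹ ALL  = yes refl
ALL  ≟ᴹ ONE  = no λ ()
ALL  ≟ᴹ NONE = no λ ()
ONE  ≟ᴹ ALL  = no λ ()
ONE  ≟ᴹ ONE  = yes refl
ONE  ≟ᴹ NONE = no λ ()
NONE ≟ᴹ ALL  = no λ ()
NONE ≟ᴹ ONE  = no λ ()
NONE ≟ᴹ NONE = yes refl

data _⊑_ : Mark → Mark → Set where
  NONE⊑ : ∀ {c} → NONE ⊑ c
  ⊑ALL  : ∀ {c} → c ⊑ ALL
  ONE⊑  : ONE ⊑ ONE

⊑-refl : ∀ c → c ⊑ c
⊑-refl ALL  = ⊑ALL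
⊑-refl ONE  = ONE⊑
⊑-refl NONE = NONE⊑

⊑-ALL : ∀ {c d} → c ⊑ d → c ≡ ALL → d ≡ ALL
⊑-ALL ⊑ALL refl = refl

⊑-NONE : ∀ {c d} → c ⊑ d → d ≡ NONE → c ≡ NONE
⊑-NONE NONE⊑ refl = refl

-- The search branches on the value at `zero`. A function is recovered from this value and its tail
-- only up to pointwise equality, which `P` must therefore respect.
anyFun? : ∀ {n} {P : (Fin n → Mark) → Set} → (∀ {s t} → (∀ u → s u ≡ t u) → P s → P t) →
          (∀ s → Dec (P s)) → Dec (∃ P)
anyFun? {zero} resp P? = map′ (λ p → _ , p) (λ (s , p) → resp (λ ()) p) (P? λ ())
anyFun? {suc n} {P} resp P? with first ALL | first ONE | first NONE
  where
  cons : Mark → (Fin n → Mark) → Fin (suc n) → Mark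
  cons c s zero    = c
  cons c s (suc u) = s u
  first : ∀ c → Dec (∃ λ s → P (cons c s))
  first c = anyFun? (λ s≗t → resp λ { zero → refl ; (suc u) → s≗t u }) (λ s → P? (cons c s))
... | yes (s , p) | _ | _ = yes (_ , p)
... | no _ | yes (s , p) | _ = yes (_ , p)
... | no _ | no _ | yes (s , p) = yes (_ , p)
... | no ¬a | no ¬o | no ¬n = no none
  where
  none : ¬ ∃ P
  none (s , p) with s zero in eq
  ... | ALL  = ¬a (s ∘ suc , resp (λ { zero → eq ; (suc u) → refl }) p)
  ... | ONE  = ¬o (s ∘ suc , resp (λ { zero → eq ; (suc u) → refl }) p)
  ... | NONE = ¬n (s ∘ suc , resp (λ { zero → eq ; (suc u) → refl }) p)

module _ {p} {X : Set} {P : X → Set p} where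

  -- Descent along the weight: pass to something lighter until `lighter?` refutes its existence.
  minimum : (weight : X → ℕ) → (∀ k → Dec (∃[ x ] (P x × weight x < k))) → ∃ P →
            ∃[ x ] (P x × (∀ y → P y → weight x ≤ weight y))
  minimum weight lighter? (x , px) = go x px (<-wellFounded _)
    where
    go : ∀ x → P x → Acc _<_ (weight x) → ∃[ x ] (P x × (∀ y → P y → weight x ≤ weight y))
    go x px (acc rec) with lighter? (weight x)
    ... | yes (y , py , y<x) = go y py (rec y<x)
    ... | no ¬lighter        = x , px , λ y py → ≮⇒≥ λ y<x → ¬lighter (y , py , y<x)

-- The game on clusters.

module Game {n : ℕ} (G : SimpleGraph n) where

  State : Set
  State = Fin n → Mark

  -- S contains the component of u in the graph of clusters that are not ALL; quantifying over
  -- such sets instead of the component itself makes Move decidable.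
  Isolates : State → Fin n → Fin n → (Fin n → Bool) → Set
  Isolates s v u S =
    S u ≡ true
    × (∀ x y → S x ≡ true → adj G x y ≡ true → s y ≢ ALL → S y ≡ true)
    × (∀ w → S w ≡ true → adj G v w ≡ true → s w ≢ ALL → w ≡ u)

  Move : State → Fin n → Fin n → Set
  Move s v u = s v ≢ NONE × adj G v u ≡ true × s u ≢ ALL × ∃[ S ] Isolates s v u S

  -- v becomes ALL along with the forced cluster u, by backforcing.
  capture : State → Fin n → Fin n → State
  capture s v u w = if ⌊ w ≟ u ⌋ ∨ ⌊ w ≟ v ⌋ then ALL else s w

  data Good (s : State) : Set where
    done : (∀ u → s u ≡ ALL) → Good s
    move : ∀ v u → Move s v u → Good (capture s v u) → Good s

  capture-elim : ∀ (P : Mark → Set) {s v u} w → P ALL → (w ≢ u → w ≢ v → P (s w)) →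
                 P (capture s v u w)
  capture-elim P {s} {v} {u} w all rest with w ≟ u | w ≟ v
  ... | yes _  | _      = all
  ... | no _   | yes _  = all
  ... | no w≢u | no w≢v = rest w≢u w≢v

  capture-target : ∀ s v u → capture s v u u ≡ ALL
  capture-target s v u rewrite ≟-refl u = refl

  ⊑-capture : ∀ s v u w → s w ⊑ capture s v u w
  ⊑-capture s v u w = capture-elim (s w ⊑_) {s} {v} {u} w ⊑ALL (λ _ _ → ⊑-refl _)

  capture-mono : ∀ {s t v u w} → s w ⊑ t w → capture s v u w ⊑ capture t v u w
  capture-mono {v = v} {u} {w} s⊑t with ⌊ w ≟ u ⌋ ∨ ⌊ w ≟ v ⌋
  ... | true  = ⊑ALL
  ... | false = s⊑t

  capture-swap : ∀ {s t v u w} → s w ⊑ t w → capture s v u w ⊑ capture t u v w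
  capture-swap {v = v} {u} {w} s⊑t with ⌊ w ≟ u ⌋ | ⌊ w ≟ v ⌋
  ... | true  | true  = ⊑ALL
  ... | true  | false = ⊑ALL
  ... | false | true  = ⊑ALL
  ... | false | false = s⊑t

  -- With all its neighbours ALL, `v` is a component by itself, so its singleton is the isolating
  -- set.
  surrounded : ∀ {s v u} → s u ≢ NONE → adj G u v ≡ true → s v ≢ ALL →
               (∀ w → adj G v w ≡ true → s w ≡ ALL) → Move s u v
  surrounded {s} {v} {u} su uv sv nbrs = su , uv , sv , (λ w → ⌊ w ≟ v ⌋)
    , ≟-refl v , closed , unique
    where
    closed : ∀ x y → ⌊ x ≟ v ⌋ ≡ true → adj G x y ≡ true → s y ≢ ALL → ⌊ y ≟ v ⌋ ≡ true
    closed x y x∈ xy sy with x ≟ v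
    ... | yes refl = contradiction (nbrs y xy) sy
    unique : ∀ w → ⌊ w ≟ v ⌋ ≡ true → adj G u w ≡ true → s w ≢ ALL → w ≡ v
    unique w w∈ _ _ with w ≟ v
    ... | yes e = e

  -- The play that wins from `s` is replayed from `t`. Raising marks keeps an isolating set
  -- isolating, so a move stays legal while its target is not ALL; if both its clusters are ALL it
  -- is skipped.
  Good-mono : ∀ {s t} → (∀ u → s u ⊑ t u) → Good s → Good t
  Good-mono s⊑t (done full) = done λ u → ⊑-ALL (s⊑t u) (full u)
  Good-mono {s} {t} s⊑t (move v u (sv , vu , su , S , u∈S , closed , unique) g)
    with t u ≟ᴹ ALL | t v ≟ᴹ ALL
  ... | no tu  | _ = move v u
          ( (λ tv → sv (⊑-NONE (s⊑t v) tv)) , vu , tu , S , u∈S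
          , (λ x y x∈ xy ty → closed x y x∈ xy λ sy → ty (⊑-ALL (s⊑t y) sy))
          , (λ w w∈ vw tw → unique w w∈ vw λ sw → tw (⊑-ALL (s⊑t w) sw)))
          (Good-mono (λ w → capture-mono {s} {t} {v} {u} {w} (s⊑t w)) g)
  ... | yes tu | yes tv = Good-mono below g
    where
    below : ∀ w → capture s v u w ⊑ t w
    below w with w ≟ u | w ≟ v
    ... | yes refl | _        = subst (ALL ⊑_) (sym tu) ⊑ALL
    ... | no _     | yes refl = subst (ALL ⊑_) (sym tv) ⊑ALL
    ... | no _     | no _     = s⊑t w
  -- If u is already ALL, then v lies in the component S, so all its other neighbours are ALL
  -- and u itself can force v.
  ... | yes tu | no tv = move u v
          (surrounded (λ tu′ → contradiction (trans (sym tu) tu′) λ ()) uv tv nbrs)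
          (Good-mono (λ w → capture-swap {s} {t} {v} {u} {w} (s⊑t w)) g)
    where
    uv : adj G u v ≡ true
    uv = trans (adj-sym G u v) vu
    nonall : ∀ {w} → t w ≢ ALL → s w ≢ ALL
    nonall tw sw = tw (⊑-ALL (s⊑t _) sw)
    nbrs : ∀ w → adj G v w ≡ true → t w ≡ ALL
    nbrs w vw = decidable-stable (t w ≟ᴹ ALL) λ tw →
      let w∈S = closed v w (closed u v u∈S uv (nonall tv)) vw (nonall tw)
      in tw (trans (cong t (unique w w∈S vw (nonall tw))) tu)

  Good-resp : ∀ {s t} → (∀ u → s u ≡ t u) → Good s → Good t
  Good-resp s≗t = Good-mono λ u → subst (_ ⊑_) (s≗t u) (⊑-refl _)

  isolates? : ∀ s v u S → Dec (Isolates s v u S)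
  isolates? s v u S =
    (S u Bool.≟ true)
    ×-dec all? (λ x → all? λ y →
      (S x Bool.≟ true) →-dec (adj G x y Bool.≟ true) →-dec ¬? (s y ≟ᴹ ALL) →-dec (S y Bool.≟ true))
    ×-dec all? (λ w →
      (S w Bool.≟ true) →-dec (adj G v w Bool.≟ true) →-dec ¬? (s w ≟ᴹ ALL) →-dec (w ≟ u))

  isolates-resp : ∀ {s v u S S′} → (∀ w → S w ≡ S′ w) → Isolates s v u S → Isolates s v u S′
  isolates-resp S≗S′ (u∈S , closed , unique) =
    trans (sym (S≗S′ _)) u∈S
    , (λ x y x∈ xy sy → trans (sym (S≗S′ y)) (closed x y (trans (S≗S′ x) x∈) xy sy))
    , (λ w w∈ → unique w (trans (S≗S′ w) w∈))

  -- Subsets are enumerated as Boolean vectors, hence the passage through `lookup` and `tabulate`.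
  move? : ∀ s v u → Dec (Move s v u)
  move? s v u =
    ¬? (s v ≟ᴹ NONE) ×-dec (adj G v u Bool.≟ true) ×-dec ¬? (s u ≟ᴹ ALL)
    ×-dec map′ (λ (S , iso) → lookup S , iso)
               (λ (S , iso) → tabulate S , isolates-resp (λ w → sym (lookup∘tabulate S w)) iso)
               (anySubset? (λ S → isolates? s v u (lookup S)))

  -- Summed over the clusters this counts those that are not ALL, the termination measure for greedy
  -- play.
  unfilled : Mark → ℕ
  unfilled ALL  = 0
  unfilled ONE  = 1
  unfilled NONE = 1

  unfilled-capture : ∀ {s v u} → s u ≢ ALL → ∑ (unfilled ∘ capture s v u) < ∑ (unfilled ∘ s)
  unfilled-capture {s} {v} {u} su = ∑-strict u
    (λ w → capture-elim (λ c → unfilled c ≤ unfilled (s w)) {s} {v} {u} w z≤n (λ _ _ → ≤-refl))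
    (subst (λ c → unfilled c < unfilled (s u)) (sym (capture-target s v u)) (positive su))
    where
    positive : ∀ {c} → c ≢ ALL → 0 < unfilled c
    positive {ALL}  c≢ALL = contradiction refl c≢ALL
    positive {ONE}  _     = ≤-refl
    positive {NONE} _     = ≤-refl

  -- By monotonicity no move can spoil a good state, so playing greedily decides goodness.
  good? : ∀ s → Dec (Good s)
  good? s = go s (<-wellFounded _)
    where
    go : ∀ s → Acc _<_ (∑ (unfilled ∘ s)) → Dec (Good s)
    go s (acc rec) with all? (λ u → s u ≟ᴹ ALL)
    ... | yes full = yes (done full)
    ... | no ¬full with any? (λ v → any? (move? s v))
    ... | yes (v , u , mv) =
      map′ (move v u mv) (Good-mono (⊑-capture s v u))
           (go (capture s v u) (rec (unfilled-capture (proj₁ (proj₂ (proj₂ mv))))))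
    ... | no stuck = no λ where
      (done full)     → ¬full full
      (move v u mv _) → stuck (v , u , mv)

  -- The number of blue vertices that the mark buys in the blowup.
  price : ℕ → Mark → ℕ
  price r ALL  = r
  price r ONE  = 1
  price r NONE = 0

  -- Descent starts from the marking that is ALL everywhere; lighter good markings are found by
  -- exhaustive search, using `good?`.
  cheapest : ∀ r → ∃[ s ] (Good s × (∀ t → Good t → ∑ (price r ∘ s) ≤ ∑ (price r ∘ t)))
  cheapest r = minimum (λ s → ∑ (price r ∘ s))
    (λ k → anyFun?
      (λ s≗t (g , s<k) → Good-resp s≗t g
        , ≤-trans (s≤s (∑-mono λ u → ≤-reflexive (cong (price r) (sym (s≗t u))))) s<k)
      (λ s → good? s ×-dec (_ <? k)))
    ((λ _ → ALL) , done λ _ → refl)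

-- Components and counting in the blowup.

module Blowup {n : ℕ} (G : SimpleGraph n) (r : ℕ) where

  -- The dichotomy behind all that follows: if this holds, the white vertices of the cluster share a
  -- component; otherwise each is a component by itself.
  WhiteNbr : Coloring G r → Fin n → Set
  WhiteNbr C u = ∃[ w ] (adj G u w ≡ true × ∃[ k ] (White G r C (w , k)))

  whiteNbr? : ∀ C u → Dec (WhiteNbr C u)
  whiteNbr? C u = any? λ w → (adj G u w Bool.≟ true) ×-dec any? λ k → C (w , k) Bool.≟ false

  white-blue-⊥ : ∀ {b} → b ≡ false → b ≡ true → ⊥
  white-blue-⊥ refl ()

  reach-white : ∀ {C x z} → Reach G r C x z → White G r C z
  reach-white (here w)     = w
  reach-white (step _ _ w) = w

  reach-start : ∀ {C x z} → Reach G r C x z → z ≡ x ⊎ WhiteNbr C (proj₁ x)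
  reach-start (here _) = inj₁ refl
  reach-start (step {z = z} p a w) with reach-start p
  ... | inj₁ refl = inj₂ (proj₁ z , a , proj₂ z , w)
  ... | inj₂ nbr  = inj₂ nbr

  reach-end : ∀ {C x z} → Reach G r C x z → z ≡ x ⊎ WhiteNbr C (proj₁ z)
  reach-end (here _) = inj₁ refl
  reach-end (step {y} {z} p a _) =
    inj₂ (proj₁ y , trans (adj-sym G (proj₁ z) (proj₁ y)) a , proj₂ y , reach-white p)

  -- The two vertices differ, so at least one path has positive length: either the path to `y`
  -- enters it from a white neighbour, or `y` is the starting point and the path to `z` leaves it
  -- through one.
  reach-both : ∀ {C x y z} → Reach G r C x y → Reach G r C x z → proj₁ y ≢ proj₁ z →
               WhiteNbr C (proj₁ y)
  reach-both p q y≢z with reach-end p | reach-start q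
  ... | inj₂ nbr  | _         = nbr
  ... | inj₁ refl | inj₁ refl = contradiction refl y≢z
  ... | inj₁ refl | inj₂ nbr  = nbr

  -- Vertices of one cluster have the same neighbours, so a detour through a white neighbour leads
  -- from one to the other.
  reach-twin : ∀ {C x u i j} → Reach G r C x (u , i) → WhiteNbr C u → White G r C (u , j) →
               Reach G r C x (u , j)
  reach-twin {u = u} p (w , uw , k , wk) uj =
    step (step p uw wk) (trans (adj-sym G w u) uw) uj

  blues : Coloring G r → Fin n → ℕ
  blues C u = ∑ λ i → indicator (C (u , i))

  hits : Coloring G r → Coloring G r → Fin n → ℕ
  hits C C′ u = ∑ λ i → indicator (not (C (u , i)) ∧ C′ (u , i))

  blues-full : ∀ {C u} → AllCluster G r C u → blues C u ≡ r
  blues-full full =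
    trans (cong sum (map-cong (λ i → cong indicator (full i)) (allFin r))) ∑-1

  blues≥1 : ∀ {C u i} → Blue G r C (u , i) → 1 ≤ blues C u
  blues≥1 {C} {u} {i} b = subst (λ c → indicator c ≤ blues C u) b (∈⇒≤sum-map _ (∈-allFin i))

  blues-one≤1 : ∀ {C u} → OneCluster G r C u → blues C u ≤ 1
  blues-one≤1 {C} {u} (i , _ , only) =
    sum-indicator≤ (λ j → C (u , j)) (i ∷ []) (Unique.allFin⁺ r) λ j _ b → here (only j b)

  blues-none : ∀ {C u} → NoneCluster G r C u → blues C u ≤ 0
  blues-none {C} {u} white =
    sum-indicator≤ (λ j → C (u , j)) [] (Unique.allFin⁺ r) λ j _ b → ⊥-elim (white-blue-⊥ (white j) b)

  -- A step that sweeps the cluster splits it into the vertices blue before and the vertices newly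
  -- colored.
  blues+hits : ∀ C C′ u → (∀ i → White G r C (u , i) → Blue G r C′ (u , i)) →
               blues C u + hits C C′ u ≡ r
  blues+hits C C′ u sweep =
    trans (sym (∑-+ (λ i → indicator (C (u , i))) _))
      (trans (cong sum (map-cong (λ i → one (C (u , i)) (C′ (u , i)) (sweep i)) (allFin r))) ∑-1)
    where
    one : ∀ b b′ → (b ≡ false → b′ ≡ true) → indicator b + indicator (not b ∧ b′) ≡ 1
    one true  _ _ = refl
    one false b′ h rewrite h refl = refl

  -- Single steps of a forcing process, and the case of `r` at least 3.

  module Force {C C′ : Coloring G r} {v} (F : OrdForce G r C v C′) where

    -- Represents the component in which `v` forces.
    source : BVert G r
    source = proj₁ (proj₂ F)

    forced⇒nbr : ∀ {y} → White G r C y → Blue G r C′ y → NbrInComp G r C v source y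
    forced⇒nbr {y} w b with Equivalence.to (proj₂ (proj₂ (proj₂ (proj₂ F))) y) b
    ... | inj₁ blue = ⊥-elim (white-blue-⊥ w blue)
    ... | inj₂ nbr  = nbr

    nbr⇒blue : ∀ {y} → NbrInComp G r C v source y → Blue G r C′ y
    nbr⇒blue nbr = Equivalence.from (proj₂ (proj₂ (proj₂ (proj₂ F))) _) (inj₂ nbr)

    grows : ∀ {y} → Blue G r C y → Blue G r C′ y
    grows b = Equivalence.from (proj₂ (proj₂ (proj₂ (proj₂ F))) _) (inj₁ b)

    some-forced : ∃[ u ] ClusterForced G r C C′ u
    some-forced with proj₁ (proj₂ (proj₂ (proj₂ F)))
    ... | (u , i) , nbr = u , i , reach-white (proj₂ nbr) , nbr⇒blue nbr

    forced-adj : ∀ {u} → ClusterForced G r C C′ u → adj G (proj₁ v) u ≡ true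
    forced-adj (_ , w , b) = proj₁ (forced⇒nbr w b)

    -- By `reach-twin` the remaining white vertices of the cluster lie in the same component, so
    -- they are forced along.
    sweep : ∀ {u} → ClusterForced G r C C′ u → WhiteNbr C u →
            ∀ j → White G r C (u , j) → Blue G r C′ (u , j)
    sweep (i , w , b) nbr j wj with forced⇒nbr w b
    ... | vu , p = nbr⇒blue (vu , reach-twin p nbr wj)

    -- Clusters forced in one step meet the same component. Combined with `sweep`, a step that
    -- forces two clusters completes both.
    forced-both : ∀ {u w} → ClusterForced G r C C′ u → ClusterForced G r C C′ w → u ≢ w →
                  WhiteNbr C u
    forced-both (_ , wi , bi) (_ , wj , bj) =
      reach-both (proj₂ (forced⇒nbr wi bi)) (proj₂ (forced⇒nbr wj bj))

    hits≤r : ∑ (hits C C′) ≤ r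
    hits≤r with proj₁ (proj₂ (proj₂ F))
    ... | L , _ , cover , L≤r = ≤-trans
      (∑∑-indicator≤ (λ y → not (C y) ∧ C′ y) L λ y h → cover y (forced⇒nbr (white h) (blue h))) L≤r
      where
      white : ∀ {b b′} → not b ∧ b′ ≡ true → b ≡ false
      white {false} _ = refl
      blue : ∀ {b b′} → not b ∧ b′ ≡ true → b′ ≡ true
      blue {false} h = h

    unforced : ∀ {u} → ¬ ClusterForced G r C C′ u → ∀ i → C′ (u , i) ≡ C (u , i)
    unforced {u} ¬f i with C (u , i) in eq
    ... | true  = grows eq
    ... | false = ¬-not λ b → ¬f (i , eq , b)

  clusterForced? : ∀ C C′ u → Dec (ClusterForced G r C C′ u)
  clusterForced? C C′ u = any? λ i → (C (u , i) Bool.≟ false) ×-dec (C′ (u , i) Bool.≟ true)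

  addCluster-blue : ∀ C v {y} → Blue G r C y → Blue G r (addCluster G r C v) y
  addCluster-blue C v b rewrite b = refl

  addCluster-own : ∀ C v i → Blue G r (addCluster G r C v) (proj₁ v , i)
  addCluster-own C v i rewrite ≟-refl (proj₁ v) = Bool.∨-zeroʳ (C (proj₁ v , i))

  addCluster-other : ∀ C v {w} i → w ≢ proj₁ v → addCluster G r C v (w , i) ≡ C (w , i)
  addCluster-other C v {w} i w≢v rewrite ≟-≢ w≢v = Bool.∨-identityʳ (C (w , i))

  addCluster-forces-one : ∀ {C v} → ¬ AllBlueCluster G r C (proj₁ v) →
                          ExactlyOneClusterForced G r C (addCluster G r C v)
  addCluster-forces-one {C} {v} ¬full with ¬∀⟶∃¬ r _ (λ i → C (proj₁ v , i) Bool.≟ true) ¬full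
  ... | i , ¬b = proj₁ v , (i , ¬-not ¬b , addCluster-own C v i) , only
    where
    only : ∀ w → ClusterForced G r C (addCluster G r C v) w → w ≡ proj₁ v
    only w (j , wj , bj) = decidable-stable (w ≟ proj₁ v) λ w≢v →
      white-blue-⊥ wj (trans (sym (addCluster-other C v j w≢v)) bj)

  -- Clusters whose white vertices are forced one by one may leave the AON pattern, but only once
  -- all their neighbours are blue, and then each force on them colors a singleton component.
  Tame : Coloring G r → Set
  Tame C = ∀ u → (AllCluster G r C u ⊎ OneCluster G r C u ⊎ NoneCluster G r C u) ⊎ ¬ WhiteNbr C u

  tame-blues≤1 : ∀ {C u i} → Tame C → White G r C (u , i) → WhiteNbr C u → blues C u ≤ 1
  tame-blues≤1 {C} {u} {i} tame w nbr with tame u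
  ... | inj₁ (inj₁ full)        = ⊥-elim (white-blue-⊥ w (full i))
  ... | inj₁ (inj₂ (inj₁ one))  = blues-one≤1 {C} one
  ... | inj₁ (inj₂ (inj₂ none)) = ≤-trans (blues-none {C} none) z≤n
  ... | inj₂ ¬nbr               = contradiction nbr ¬nbr

  -- Two clusters forced together would both be completed, and tameness leaves each at most one blue
  -- vertex beforehand. The step would then color at least `2r - 2` vertices, but it colors at most
  -- `r`.
  tame-forces-one : ∀ {C C′ v} → 3 ≤ r → Tame C → OrdForce G r C v C′ →
                    ExactlyOneClusterForced G r C C′
  tame-forces-one {C} {C′} 3≤r tame F with Force.some-forced F
  ... | u , fu = u , fu , λ w fw → decidable-stable (w ≟ u) λ w≢u → crowded fw w≢u
    where
    open Force F
    rich : ∀ {w} → ClusterForced G r C C′ w → WhiteNbr C w → r ≤ 1 + hits C C′ w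
    rich {w} fw@(i , wi , _) nbr = subst (_≤ 1 + hits C C′ w) (blues+hits C C′ w (sweep fw nbr))
      (+-monoˡ-≤ (hits C C′ w) (tame-blues≤1 {C} tame wi nbr))
    crowded : ∀ {w} → ClusterForced G r C C′ w → w ≢ u → ⊥
    crowded {w} fw w≢u = <⇒≱ 3≤r (+-cancelʳ-≤ r r 2 (begin
      r + r                                ≤⟨ +-mono-≤ (rich fw (forced-both fw fu w≢u))
                                                       (rich fu (forced-both fu fw (w≢u ∘ sym))) ⟩
      (1 + hits C C′ w) + (1 + hits C C′ u) ≡⟨ cong suc (+-suc (hits C C′ w) (hits C C′ u)) ⟩
      2 + (hits C C′ w + hits C C′ u)       ≤⟨ +-monoʳ-≤ 2 (∑-two (hits C C′) w≢u) ⟩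
      2 + ∑ (hits C C′)                     ≤⟨ +-monoʳ-≤ 2 hits≤r ⟩
      2 + r                                 ∎))
      where open ≤-Reasoning

  aon-resp : ∀ {C C′ u} → (∀ i → C′ (u , i) ≡ C (u , i)) →
             AllCluster G r C u ⊎ OneCluster G r C u ⊎ NoneCluster G r C u →
             AllCluster G r C′ u ⊎ OneCluster G r C′ u ⊎ NoneCluster G r C′ u
  aon-resp eq (inj₁ full)                   = inj₁ λ i → trans (eq i) (full i)
  aon-resp eq (inj₂ (inj₁ (i , b , only))) =
    inj₂ (inj₁ (i , trans (eq i) b , λ j bj → only j (trans (sym (eq j)) bj)))
  aon-resp eq (inj₂ (inj₂ none))            = inj₂ (inj₂ λ i → trans (eq i) (none i))

  tame-resp : ∀ {C C′ u} → Tame C → (∀ {y} → Blue G r C y → Blue G r C′ y) →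
              (∀ i → C′ (u , i) ≡ C (u , i)) →
              (AllCluster G r C′ u ⊎ OneCluster G r C′ u ⊎ NoneCluster G r C′ u) ⊎ ¬ WhiteNbr C′ u
  tame-resp {C} {C′} {u} tame grows eq with tame u
  ... | inj₁ aon  = inj₁ (aon-resp {C} {C′} eq aon)
  ... | inj₂ ¬nbr = inj₂ λ (w , a , k , wk) →
    ¬nbr (w , a , k , ¬-not λ b → white-blue-⊥ wk (grows b))

  -- A forced cluster with a white neighbour is swept and becomes All. One without a white neighbour
  -- never regains any, since blue vertices stay blue.
  tame-process : ∀ {B m C} → 3 ≤ r → IsAON G r B → (p : Proc G r B m C) →
                 Tame C × EachStepOneCluster G r p
  tame-process 3≤r aon start = (λ u → inj₁ (aon u)) , _
  tame-process 3≤r aon (force {C = C} {C′} v p F) with tame-process 3≤r aon p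
  ... | tame , each = tame′ , each , tame-forces-one 3≤r tame F
    where
    open Force F
    tame′ : Tame C′
    tame′ u with clusterForced? C C′ u | whiteNbr? C u
    ... | no ¬f | _       = tame-resp {C} tame grows (unforced ¬f)
    ... | yes f | no ¬nbr = inj₂ λ (w , a , k , wk) →
      ¬nbr (w , a , k , ¬-not λ b → white-blue-⊥ wk (grows b))
    ... | yes f | yes nbr = inj₁ (inj₁ λ i → full i)
      where
      full : AllCluster G r C′ u
      full i with C (u , i) in eq
      ... | true  = grows eq
      ... | false = sweep f nbr i eq
  tame-process 3≤r aon (back {C} v p ¬full) with tame-process 3≤r aon p
  ... | tame , each = tame′ , each , addCluster-forces-one {C} {v} ¬full
    where
    tame′ : Tame (addCluster G r C v)
    tame′ u = case u ≟ proj₁ v of λ where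
      (yes refl) → inj₁ (inj₁ (addCluster-own C v))
      (no u≢v)   → tame-resp {C} tame (addCluster-blue C v) λ i → addCluster-other C v i u≢v

  -- Realising the game in the blowup.

  open Game G

  -- Only what a move uses is kept, so a NONE cluster may contain blue vertices: `full` confines
  -- components, `gap` leaves something to force or backforce, and `seed` supplies the forcing
  -- vertex.
  record Realises (C : Coloring G r) (s : State) : Set where
    field
      full : ∀ u → s u ≡ ALL → AllCluster G r C u
      gap  : ∀ u → s u ≢ ALL → ∃[ i ] White G r C (u , i)
      seed : ∀ u → s u ≢ NONE → ∃[ i ] Blue G r C (u , i)

    white⇒¬ALL : ∀ {u i} → White G r C (u , i) → s u ≢ ALL
    white⇒¬ALL {u} {i} w su = white-blue-⊥ w (full u su i)

  open Realises

  -- The index `i₀` witnesses that clusters are nonempty, which `seed` needs at the captured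
  -- clusters.
  realises-capture : ∀ {C C′ s v u} → Fin r → Realises C s → (∀ y → Blue G r C y → Blue G r C′ y) →
                     (∀ w i → w ≢ u → w ≢ v → C′ (w , i) ≡ C (w , i)) →
                     AllCluster G r C′ u → AllCluster G r C′ v → Realises C′ (capture s v u)
  realises-capture {C} {C′} {s} {v} {u} i₀ R grows same fullᵘ fullᵛ = record
    { full = λ w → fulls w
    ; gap  = gaps
    ; seed = seeds
    }
    where
    fulls : ∀ w → capture s v u w ≡ ALL → AllCluster G r C′ w
    fulls w sw with w ≟ u | w ≟ v
    ... | yes refl | _        = fullᵘ
    ... | no _     | yes refl = fullᵛ
    ... | no _     | no _     = λ i → grows _ (full R w sw i)
    gaps : ∀ w → capture s v u w ≢ ALL → ∃[ i ] White G r C′ (w , i)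
    gaps w sw with w ≟ u | w ≟ v
    ... | yes _  | _      = contradiction refl sw
    ... | no _   | yes _  = contradiction refl sw
    ... | no w≢u | no w≢v with gap R w sw
    ... | i , wi = i , trans (same w i w≢u w≢v) wi
    seeds : ∀ w → capture s v u w ≢ NONE → ∃[ i ] Blue G r C′ (w , i)
    seeds w sw with w ≟ u | w ≟ v
    ... | yes refl | _        = i₀ , fullᵘ i₀

    ... | no _     | yes refl = i₀ , fullᵛ i₀

    ... | no _     | no _ with seed R w sw
    ... | i , bi = i , grows _ bi

  atMost-cluster : ∀ {P : BVert G r → Set} {u} → (∀ y → P y → proj₁ y ≡ u) → AtMost G r r P
  atMost-cluster {P} {u} within =
    map (u ,_) (allFin r)
    , Unique.map⁺ (λ { refl → refl }) (Unique.allFin⁺ r)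
    , (λ y py → member y (within y py))
    , ≤-reflexive (trans (length-map (u ,_) (allFin r)) (length-tabulate {n = r} (λ i → i)))
    where
    member : ∀ y → proj₁ y ≡ u → y ∈ map (u ,_) (allFin r)
    member (_ , i) refl = ∈-map⁺ (u ,_) (∈-allFin i)

  forces-one : ∀ {C C′ v u} (F : OrdForce G r C v C′) →
               (∀ y → NbrInComp G r C v (Force.source F) y → proj₁ y ≡ u) →
               ExactlyOneClusterForced G r C C′
  forces-one {C} {C′} F within with Force.some-forced F
  ... | u′ , i , wi , bi = u′ , (i , wi , bi) , λ w (j , wj , bj) →
    trans (within _ (Force.forced⇒nbr F wj bj)) (sym (within _ (Force.forced⇒nbr F wi bi)))

  addCluster-inv : ∀ C v y → Blue G r (addCluster G r C v) y →
                   Blue G r C y ⊎ (White G r C y × proj₁ y ≡ proj₁ v)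
  addCluster-inv C v y b with C y | proj₁ y ≟ proj₁ v
  ... | true  | _      = inj₁ refl
  ... | false | yes eq = inj₂ (refl , eq)

  -- White vertices lie in clusters that are not ALL, so a component of the blowup projects into the
  -- closed set `S`, where `u` is the only neighbour of `v` that is not ALL.
  force-within : ∀ {C s v u i k} → Realises C s → Move s v u →
                 ∀ y → NbrInComp G r C (v , k) (u , i) y → proj₁ y ≡ u
  force-within {C} {s} {v} {u} {i} R (_ , _ , _ , S , u∈S , closed , unique) y (vy , p) =
    unique (proj₁ y) (inside p) vy (white⇒¬ALL R (reach-white p))
    where
    inside : ∀ {z} → Reach G r C (u , i) z → S (proj₁ z) ≡ true
    inside (here _)     = u∈S
    inside (step p a w) = closed _ _ (inside p) a (white⇒¬ALL R w)

  -- The white neighbour puts all white vertices of the cluster into one component, so the force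
  -- colors exactly the rest of the cluster.
  force-cluster : ∀ {C v u i k} → adj G v u ≡ true →
                  (∀ y → NbrInComp G r C (v , k) (u , i) y → proj₁ y ≡ u) →
                  White G r C (u , i) → Blue G r C (v , k) → WhiteNbr C u →
                  OrdForce G r C (v , k) (addCluster G r C (u , i))
  force-cluster {C} {v} {u} {i} {k} vu within wi bk nbr =
    bk , (u , i) , atMost-cluster within , ((u , i) , vu , here wi) , λ y → mk⇔ (to y) (from y)
    where
    to : ∀ y → Blue G r (addCluster G r C (u , i)) y →
         Blue G r C y ⊎ NbrInComp G r C (v , k) (u , i) y
    to (w , j) b with addCluster-inv C (u , i) (w , j) b
    ... | inj₁ blue        = inj₁ blue
    ... | inj₂ (wj , refl) = inj₂ (vu , reach-twin (here wi) nbr wj)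
    from : ∀ y → Blue G r C y ⊎ NbrInComp G r C (v , k) (u , i) y →
           Blue G r (addCluster G r C (u , i)) y
    from y (inj₁ blue) = addCluster-blue C (u , i) blue
    from y@(w , j) (inj₂ h) with within y h
    ... | refl = addCluster-own C (u , i) j

  _≟ᵇ_ : (x y : BVert G r) → Dec (x ≡ y)
  _≟ᵇ_ = ≡-dec _≟_ _≟_

  paint : Coloring G r → BVert G r → Coloring G r
  paint C x y = C y ∨ ⌊ y ≟ᵇ x ⌋

  paint-blue : ∀ C x {y} → Blue G r C y → Blue G r (paint C x) y
  paint-blue C x b rewrite b = refl

  paint-own : ∀ C x → Blue G r (paint C x) x
  paint-own C x with x ≟ᵇ x
  ... | yes _  = Bool.∨-zeroʳ (C x)
  ... | no x≢x = contradiction refl x≢x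

  paint-other : ∀ C x y → y ≢ x → paint C x y ≡ C y
  paint-other C x y y≢x with y ≟ᵇ x
  ... | yes y≡x = contradiction y≡x y≢x
  ... | no _    = Bool.∨-identityʳ (C y)

  force-single : ∀ {C v u i} → adj G (proj₁ v) u ≡ true → White G r C (u , i) → Blue G r C v →
                 ¬ WhiteNbr C u → OrdForce G r C v (paint C (u , i))
  force-single {C} {v} {u} {i} vu wi bv ¬nbr =
    bv , (u , i) , atMost-cluster (λ y h → cong proj₁ (alone (proj₂ h)))
    , ((u , i) , vu , here wi) , λ y → mk⇔ (to y) (from y)
    where
    alone : ∀ {y} → Reach G r C (u , i) y → y ≡ (u , i)
    alone p with reach-start p
    ... | inj₁ eq  = eq
    ... | inj₂ nbr = contradiction nbr ¬nbr
    to : ∀ y → Blue G r (paint C (u , i)) y → Blue G r C y ⊎ NbrInComp G r C v (u , i) y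
    to y b = case y ≟ᵇ (u , i) of λ where
      (yes refl) → inj₂ (vu , here wi)
      (no y≢x)   → inj₁ (trans (sym (paint-other C (u , i) y y≢x)) b)
    from : ∀ y → Blue G r C y ⊎ NbrInComp G r C v (u , i) y → Blue G r (paint C (u , i)) y
    from y (inj₁ b) = paint-blue C (u , i) b
    from y (inj₂ h) with alone (proj₂ h)
    ... | refl = paint-own C (u , i)

  -- When all neighbours of u are blue, its white vertices are singleton components
  -- and have to be forced one at a time.
  fill : ∀ {B v u} js {m C} (p : Proc G r B m C) → EachStepOneCluster G r p →
         adj G (proj₁ v) u ≡ true → Blue G r C v → ¬ WhiteNbr C u →
         ∃[ m′ ] ∃[ C′ ] ∃[ p′ ]
           ( EachStepOneCluster G r {B} {m′} {C′} p′
           × (∀ y → Blue G r C y → Blue G r C′ y)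
           × (∀ w i → w ≢ u → C′ (w , i) ≡ C (w , i))
           × (∀ j → j ∈ js → Blue G r C′ (u , j)))
  fill [] p each vu bv ¬nbr = _ , _ , p , each , (λ _ b → b) , (λ _ _ _ → refl) , λ _ ()
  fill {B} {v} {u} (i ∷ js) {C = C} p each vu bv ¬nbr with C (u , i) in eq
  ... | true = case fill js p each vu bv ¬nbr of λ where
      (m′ , C′ , p′ , each′ , grows , same , filled) →
        m′ , C′ , p′ , each′ , grows , same
        , λ { _ (here refl) → grows _ eq ; j (there j∈) → filled j j∈ }
  ... | false = case fill js (force v p F) (each , forces-one F within) vu
                     (paint-blue C x bv) (λ (w , a , k , wk) → ¬nbr (w , a , k ,
                        ¬-not λ b → white-blue-⊥ wk (paint-blue C x b))) of λ where
      (m′ , C′ , p′ , each′ , grows , same , filled) →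
        m′ , C′ , p′ , each′ , (λ y b → grows y (paint-blue C x b))
        , (λ w j w≢u → trans (same w j w≢u) (paint-other C x (w , j) (w≢u ∘ cong proj₁)))
        , λ { _ (here refl) → grows _ (paint-own C x) ; j (there j∈) → filled j j∈ }
    where
    x = (u , i)
    F = force-single {C} {v} {u} {i} vu eq bv ¬nbr
    within : ∀ y → NbrInComp G r C v x y → proj₁ y ≡ u
    within y (_ , p) with reach-start p
    ... | inj₁ refl = refl
    ... | inj₂ nbr  = contradiction nbr ¬nbr

  Completes : Coloring G r → Set
  Completes B = ∃[ m ] ∃[ C ] ∃[ p ] (AllBlue G r C × EachStepOneCluster G r {B} {m} {C} p)

  -- Each move becomes a run of single-cluster steps; the cases are whether `u` has a white
  -- neighbour and whether `v` is already ALL.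
  play : ∀ {B m C s} → Good s → Realises C s → (p : Proc G r B m C) → EachStepOneCluster G r p →
         Completes B
  play (done allˢ) R p each = _ , _ , p , (λ (u , i) → full R u (allˢ u) i) , each
  play {B} {C = C} {s} (move v u mv@(sv , vu , su , _) g) R p each
    with gap R u su | seed R v sv | whiteNbr? C u | s v ≟ᴹ ALL
  -- A cluster `v` that is not ALL has a white vertex, which would be a white neighbour of `u`.
  ... | i , wi | k , bk | no ¬nbr | no ¬sv =
    let j , wj = gap R v ¬sv in contradiction (v , trans (adj-sym G u v) vu , j , wj) ¬nbr
  ... | i , wi | k , bk | no ¬nbr | yes sv=ALL with fill {v = v , k} (allFin r) p each vu bk ¬nbr
  ... | _ , C′ , p′ , each′ , grows , same , filled =
    play g (realises-capture i R grows (λ w i w≢u _ → same w i w≢u)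
              (λ i → filled i (∈-allFin i)) (λ i → grows _ (full R v sv=ALL i)))
         p′ each′
  play {B} {C = C} {s} (move v u mv@(sv , vu , su , _) g) R p each
      | i , wi | k , bk | yes nbr | yes sv=ALL =
    play g (realises-capture i R (λ _ → addCluster-blue C x) (λ w i w≢u _ → addCluster-other C x i w≢u)
              (addCluster-own C x) (λ i → addCluster-blue C x (full R v sv=ALL i)))
         (force (v , k) p F) (each , forces-one F within)
    where
    x = (u , i)
    within = force-within {C} {s} {v} {u} {i} {k} R mv
    F = force-cluster {C} vu within wi bk nbr
  -- Forcing `u` leaves the white vertex of `v` untouched because `v` and `u` differ, so backforcing
  -- `v` is legal and colors something.
  play {B} {C = C} {s} (move v u mv@(sv , vu , su , _) g) R p each
      | i , wi | k , bk | yes nbr | no ¬sv =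
    play g (realises-capture i R (λ _ b → addCluster-blue C₁ (v , k) (addCluster-blue C x b))
              (λ w i w≢u w≢v → trans (addCluster-other C₁ (v , k) i w≢v) (addCluster-other C x i w≢u))
              (λ i → addCluster-blue C₁ (v , k) (addCluster-own C x i)) (addCluster-own C₁ (v , k)))
         (back (v , k) (force (v , k) p F) unfull)
         ((each , forces-one F within) , addCluster-forces-one {C₁} {v , k} unfull)
    where
    x = (u , i)
    C₁ = addCluster G r C x
    within = force-within {C} {s} {v} {u} {i} {k} R mv
    F = force-cluster {C} vu within wi bk nbr
    v≢u : v ≢ u
    v≢u refl = white-blue-⊥ (irrefl G v) vu
    unfull : ¬ AllBlueCluster G r C₁ v
    unfull f with gap R v ¬sv
    ... | j , wj = white-blue-⊥ (trans (addCluster-other C x j v≢u) wj) (f j)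

  -- Extracting a marking from a forcing process.

  Plan : Set
  Plan = Fin n → Maybe Mark

  Agrees : State → Plan → Set
  Agrees s π = ∀ u c → π u ≡ just c → s u ≡ c

  -- An upper bound for the actual coloring: a planned cluster counts as ALL even while it still has
  -- white vertices.
  settle : Plan → State → State
  settle π s u = maybe′ (λ _ → ALL) (s u) (π u)

  -- Interpolates between the size of `B`, when nothing is planned, and the price of the marking,
  -- when everything is.
  bill : Coloring G r → Plan → Fin n → ℕ
  bill B π u = maybe′ (price r) (blues B u) (π u)

  -- The older plan has priority: a mark once chosen is never revised.
  _⊕_ : Plan → Plan → Plan
  (π ⊕ ρ) u = π u <∣> ρ u

  settle-nothing : ∀ π s {u} → π u ≡ nothing → settle π s u ≡ s u
  settle-nothing π s eq rewrite eq = refl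

  settle-open : ∀ π s {u} → settle π s u ≢ ALL → π u ≡ nothing
  settle-open π s {u} su with π u
  ... | just _  = contradiction refl su
  ... | nothing = refl

  ⊕-right : ∀ π ρ {u} → π u ≡ nothing → (π ⊕ ρ) u ≡ ρ u
  ⊕-right π ρ eq rewrite eq = refl

  -- The larger plan raises only newly planned clusters to ALL, and this changes nothing where `s`
  -- is ALL there already.
  settle-⊕ : ∀ π ρ s {u c} → (∀ d → ρ u ≡ just d → π u ≡ nothing → s u ≡ ALL) →
             settle π s u ⊑ c → settle (π ⊕ ρ) s u ⊑ c
  settle-⊕ π ρ s {u} new below with π u | ρ u
  ... | just _  | _       = below
  ... | nothing | just d  = subst (_⊑ _) (new d refl refl) below
  ... | nothing | nothing = below

  -- The plan records, for every cluster touched so far, the mark it should get at the start;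
  -- untouched clusters still look as they did in B.
  record Simulation (B : Coloring G r) (m : Maybe (BVert G r)) (C : Coloring G r) : Set where
    field
      plan      : Plan
      untouched : ∀ u → plan u ≡ nothing → ∀ i → C (u , i) ≡ B (u , i)
      hole      : ∀ u → plan u ≡ nothing → ∃[ i ] White G r C (u , i)
      -- Ensures that a backforcing step acts on a planned cluster.
      forcer    : ∀ v → m ≡ just v → plan (proj₁ v) ≢ nothing
      cost      : ∑ (bill B plan) ≤ count G r B
      -- Quantified over all `s` extending the plan, since marks of untouched clusters are still to
      -- be chosen; from any such `s` the settled state can be won through.
      strategy  : ∀ s → Agrees s plan → Good (settle plan s) → Good s

  -- Clusters entirely blue in `B` are planned as ALL at once, at the price of their `r` blue
  -- vertices; every other cluster then has the white vertex required by `hole`.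
  simulate-start : ∀ B → Simulation B nothing B
  simulate-start B = record
    { plan = plan₀
    ; untouched = λ _ _ _ → refl
    ; hole = hole₀
    ; forcer = λ _ ()
    ; cost = ∑-mono cost₀
    ; strategy = λ s agrees → Good-mono (below s agrees)
    }
    where
    full? : ∀ u → Dec (AllCluster G r B u)
    full? u = all? λ i → B (u , i) Bool.≟ true
    plan₀ : Plan
    plan₀ u with full? u
    ... | yes _ = just ALL
    ... | no _  = nothing
    hole₀ : ∀ u → plan₀ u ≡ nothing → ∃[ i ] White G r B (u , i)
    hole₀ u eq with full? u
    ... | no ¬full with ¬∀⟶∃¬ r _ (λ i → B (u , i) Bool.≟ true) ¬full
    ... | i , ¬b = i , ¬-not ¬b
    cost₀ : ∀ u → bill B plan₀ u ≤ blues B u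
    cost₀ u with full? u
    ... | yes full = ≤-reflexive (sym (blues-full {B} full))
    ... | no _     = ≤-refl
    below : ∀ s → Agrees s plan₀ → ∀ u → settle plan₀ s u ⊑ s u
    below s agrees u with full? u | agrees u
    ... | yes _ | agr rewrite agr ALL refl = ⊑ALL
    ... | no _  | _ = ⊑-refl (s u)

  simulate-back : ∀ {B C v} → Simulation B (just v) C → Simulation B nothing (addCluster G r C v)
  simulate-back {B} {C} {v} sim = record
    { plan = plan
    ; untouched = λ u eq i → trans (addCluster-other C v i (apart u eq)) (untouched u eq i)
    ; hole = λ u eq → let i , w = hole u eq in i , trans (addCluster-other C v i (apart u eq)) w
    ; forcer = λ _ ()
    ; cost = cost
    ; strategy = strategy
    }
    where
    open Simulation sim
    apart : ∀ u → plan u ≡ nothing → u ≢ proj₁ v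
    apart u eq refl = forcer v refl eq

  module _ {B C C′ : Coloring G r} {v m} (sim : Simulation B m C) (F : OrdForce G r C v C′) where

    open Simulation sim
    open Force F

    private
      cv = proj₁ v

    -- The obligations common to both kinds of force: `ρ` must cover the forcer and all newly hit
    -- clusters, and what is left are the cost and the moves.
    extend : ∀ ρ → (∀ u → plan u ≡ nothing → ρ u ≡ nothing → ¬ ClusterForced G r C C′ u) →
             ρ cv ≢ nothing → ∑ (bill B (plan ⊕ ρ)) ≤ ∑ (bill B plan) →
             (∀ s → Agrees s (plan ⊕ ρ) → Good (settle (plan ⊕ ρ) s) → Good (settle plan s)) →
             Simulation B (just v) C′
    extend ρ unhit ρcv cheaper moves = record
      { plan = plan ⊕ ρ
      ; untouched = λ u eq i → let a , b = both u eq in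
          trans (unforced (unhit u a b) i) (untouched u a i)
      ; hole = λ u eq → let a , b = both u eq ; i , w = hole u a in
          i , trans (unforced (unhit u a b) i) w
      ; forcer = λ { _ refl eq → ρcv (proj₂ (both cv eq)) }
      ; cost = ≤-trans cheaper cost
      ; strategy = λ s agrees g → strategy s (weaken s agrees) (moves s agrees g)
      }
      where
      both : ∀ u → (plan ⊕ ρ) u ≡ nothing → plan u ≡ nothing × ρ u ≡ nothing
      both u eq with plan u
      ... | nothing = refl , eq
      weaken : ∀ s → Agrees s (plan ⊕ ρ) → Agrees s plan
      weaken s agrees u c eq = agrees u c (cong (_<∣> ρ u) eq)

    -- An untouched forcing cluster looks as in `B`, so the forcing vertex was blue there and pays
    -- for the mark ONE.
    blues-forcer : plan cv ≡ nothing → 1 ≤ blues B cv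
    blues-forcer eq = blues≥1 {B} (trans (sym (untouched cv eq (proj₂ v))) (proj₁ F))

    Fresh : Fin n → Set
    Fresh u = plan u ≡ nothing × ClusterForced G r C C′ u

    fresh? : ∀ u → Dec (Fresh u)
    fresh? u = unplanned? (plan u) ×-dec clusterForced? C C′ u
      where
      unplanned? : (x : Maybe Mark) → Dec (x ≡ nothing)
      unplanned? nothing  = yes refl
      unplanned? (just _) = no λ ()

    -- A cluster not ALL in the settled state is unplanned, so `hole` gives it a white vertex
    -- through which the path continues.
    open-reach : ∀ {s w x} → Reach G r C source x → adj G (proj₁ x) w ≡ true →
                 settle plan s w ≢ ALL → ∃[ j ] Reach G r C source (w , j)
    open-reach {s} {w} p a sw with hole w (settle-open plan s sw)
    ... | j , wj = j , step p a wj

    -- Every forced cluster is already planned, so only the forcer can be new to the plan; it is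
    -- marked ONE.
    simulate-stale : ¬ ∃ Fresh → Simulation B (just v) C′
    simulate-stale stale = extend ρ (λ u eq _ hit → stale (u , eq , hit)) ρcv (∑-mono cheaper) moves
      where
      ρ : Plan
      ρ u with u ≟ cv
      ... | yes _ = just ONE
      ... | no _  = nothing
      ρcv≡ : ρ cv ≡ just ONE
      ρcv≡ with cv ≟ cv
      ... | yes _  = refl
      ... | no cv≢ = contradiction refl cv≢
      ρcv : ρ cv ≢ nothing
      ρcv eq with trans (sym ρcv≡) eq
      ... | ()
      ρ-off : ∀ {u d} → ρ u ≡ just d → u ≡ cv
      ρ-off {u} eq with u ≟ cv
      ... | yes u≡cv = u≡cv
      cheaper : ∀ u → bill B (plan ⊕ ρ) u ≤ bill B plan u
      cheaper u with plan u in eq | u ≟ cv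
      ... | just _  | _        = ≤-refl
      ... | nothing | yes refl = blues-forcer eq
      ... | nothing | no _     = ≤-refl
      moves : ∀ s → Agrees s (plan ⊕ ρ) → Good (settle (plan ⊕ ρ) s) → Good (settle plan s)
      moves s agrees g with plan cv in eq
      ... | just c = Good-mono (λ u → settle-⊕ plan ρ s
              (λ d ρu πu → contradiction
                (trans (sym eq) (subst (λ w → plan w ≡ nothing) (ρ-off ρu) πu)) λ ())
              (⊑-refl _)) g
      ... | nothing with some-forced
      -- The roles are reversed: the forced cluster `y` is ALL in the settled state and captures the
      -- forcer.
      ... | y , hit@(i , wi , bi) = move y cv
              (surrounded {t} {cv} {y} (λ ty → contradiction (trans (sym ty) y≡ALL) λ ())
                (trans (adj-sym G y cv) (forced-adj hit)) cv≢ALL nbrs)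
              (Good-mono below g)
        where
        t = settle plan s
        y≡ALL : t y ≡ ALL
        y≡ALL with plan y in eqʸ
        ... | just _  = refl
        ... | nothing = contradiction (y , eqʸ , hit) stale
        cv≢ALL : t cv ≢ ALL
        cv≢ALL tcv with trans (sym (agrees cv ONE (trans (⊕-right plan ρ eq) ρcv≡)))
                              (trans (sym (settle-nothing plan s eq)) tcv)
        ... | ()
        nbrs : ∀ w → adj G cv w ≡ true → t w ≡ ALL
        -- A neighbour `w` of the forcer that is not ALL would be reached from `y` through a white
        -- vertex of the forcer's own cluster, hence be forced in this step and be fresh.
        nbrs w a = decidable-stable (t w ≟ᴹ ALL) λ tw →
          let vy , p = forced⇒nbr wi bi
              j , q  = open-reach {s} p (trans (adj-sym G y cv) vy) cv≢ALL
              k , q′ = open-reach {s} q a tw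
          in stale (w , settle-open plan s tw , k , reach-white q′ , nbr⇒blue (a , q′))
        below : ∀ w → settle (plan ⊕ ρ) s w ⊑ capture t y cv w
        below w = capture-elim (settle (plan ⊕ ρ) s w ⊑_) {t} {y} {cv} w ⊑ALL λ w≢cv _ →
          settle-⊕ plan ρ s (λ d ρw _ → contradiction (ρ-off ρw) w≢cv) (⊑-refl _)

    -- Among the k clusters forced for the first time in one step, at most r vertices are white
    -- in total, so at least (k - 1) r are blue: enough to pay for making all but one of them ALL.
    simulate-fresh : ∀ u₁ → Fresh u₁ → Simulation B (just v) C′
    simulate-fresh u₁ (open₁ , hit₁) = extend ρ unhit ρcv cheaper moves
      where
      -- This also assigns marks to clusters planned earlier, but `_⊕_` ignores those.
      ρ : Plan
      ρ u with u ≟ u₁ | clusterForced? C C′ u | u ≟ cv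
      ... | yes _ | _     | _     = just NONE
      ... | no _  | yes _ | _     = just ALL
      ... | no _  | no _  | yes _ = just ONE
      ... | no _  | no _  | no _  = nothing
      cv≢u₁ : cv ≢ u₁
      cv≢u₁ refl = white-blue-⊥ (irrefl G cv) (forced-adj hit₁)
      ρ-target : ρ u₁ ≡ just NONE
      ρ-target with u₁ ≟ u₁
      ... | yes _  = refl
      ... | no u≢u = contradiction refl u≢u
      ρ-hit : ∀ {u} → u ≢ u₁ → ClusterForced G r C C′ u → ρ u ≡ just ALL
      ρ-hit {u} u≢u₁ hit with u ≟ u₁ | clusterForced? C C′ u
      ... | yes u≡u₁ | _       = contradiction u≡u₁ u≢u₁
      ... | no _     | yes _   = refl
      ... | no _     | no ¬hit = contradiction hit ¬hit
      ρ-forcer : ∃[ c ] (ρ cv ≡ just c × c ≢ NONE)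
      ρ-forcer with cv ≟ u₁ | clusterForced? C C′ cv | cv ≟ cv
      ... | yes cv≡u₁ | _     | _      = contradiction cv≡u₁ cv≢u₁
      ... | no _      | yes _ | _      = ALL , refl , λ ()
      ... | no _      | no _  | yes _  = ONE , refl , λ ()
      ... | no _      | no _  | no cv≢ = contradiction refl cv≢
      ρ-new : ∀ {u d} → ρ u ≡ just d → u ≡ u₁ ⊎ u ≡ cv ⊎ ρ u ≡ just ALL
      ρ-new {u} eq with u ≟ u₁ | clusterForced? C C′ u | u ≟ cv
      ... | yes u≡u₁ | _     | _        = inj₁ u≡u₁
      ... | no _     | yes _ | _        = inj₂ (inj₂ refl)
      ... | no _     | no _  | yes u≡cv = inj₂ (inj₁ u≡cv)
      ρcv : ρ cv ≢ nothing
      ρcv eq with ρ-forcer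
      ... | _ , eq′ , _ with trans (sym eq) eq′
      ... | ()
      unhit : ∀ u → plan u ≡ nothing → ρ u ≡ nothing → ¬ ClusterForced G r C C′ u
      unhit u _ eq hit with u ≟ u₁ | clusterForced? C C′ u
      ... | no _ | no ¬hit = ¬hit hit

      cheaper : ∑ (bill B (plan ⊕ ρ)) ≤ ∑ (bill B plan)
      cheaper with any? (λ u → ¬? (u ≟ u₁) ×-dec fresh? u)
      -- With `u₁` as the only fresh cluster, its bill drops to 0 and nothing else grows.
      ... | no ¬other = ∑-mono pointwise
        where
        pointwise : ∀ u → bill B (plan ⊕ ρ) u ≤ bill B plan u
        pointwise u with plan u in eq | u ≟ u₁ | clusterForced? C C′ u | u ≟ cv
        ... | just _  | _        | _       | _        = ≤-refl
        ... | nothing | yes _    | _       | _        = z≤n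
        ... | nothing | no u≢u₁  | yes hit | _        = contradiction (u , u≢u₁ , eq , hit) ¬other
        ... | nothing | no _     | no _    | yes refl = blues-forcer eq
        ... | nothing | no _     | no _    | no _     = ≤-refl
      -- With two fresh clusters every fresh one is swept, so its blue vertices in `B` and its hits
      -- add up to `r`. Hence adding `r` at `u₁` on the left and the hits on the right gives a
      -- pointwise inequality; all hits together are at most `r`, which cancels.
      ... | yes (u₂ , u₂≢u₁ , _ , hit₂) = +-cancelʳ-≤ r _ _ (begin
        ∑ (bill B (plan ⊕ ρ)) + r                ≤⟨ ∑-bump u₁ pointwise ⟩
        ∑ (λ u → bill B plan u + hits C C′ u)    ≡⟨ ∑-+ (bill B plan) (hits C C′) ⟩
        ∑ (bill B plan) + ∑ (hits C C′)          ≤⟨ +-monoʳ-≤ (∑ (bill B plan)) hits≤r ⟩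
        ∑ (bill B plan) + r                      ∎)
        where
        open ≤-Reasoning
        whole : ∀ {u} → plan u ≡ nothing → ClusterForced G r C C′ u → WhiteNbr C u →
                r ≤ blues B u + hits C C′ u
        whole {u} eq hit nbr = ≤-reflexive (trans (sym (blues+hits C C′ u (sweep hit nbr)))
          (cong (λ b → b + hits C C′ u)
            (cong sum (map-cong (λ i → cong indicator (untouched u eq i)) (allFin r)))))
        pointwise : ∀ u → bill B (plan ⊕ ρ) u + δ u₁ r u ≤ bill B plan u + hits C C′ u
        pointwise u with plan u in eq | u ≟ u₁ | clusterForced? C C′ u | u ≟ cv
        ... | just _  | yes refl | _       | _        = contradiction (trans (sym eq) open₁) λ ()
        ... | just c  | no _     | _       | _        = +-monoʳ-≤ (price r c) z≤n
        ... | nothing | yes refl | _       | _        =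
          whole eq hit₁ (forced-both hit₁ hit₂ (u₂≢u₁ ∘ sym))
        ... | nothing | no u≢u₁  | yes hit | _        =
          ≤-trans (≤-reflexive (+-identityʳ r)) (whole eq hit (forced-both hit hit₁ u≢u₁))
        ... | nothing | no _     | no _    | yes refl = +-mono-≤ (blues-forcer eq) z≤n
        ... | nothing | no _     | no _    | no _     = +-monoʳ-≤ (blues B u) z≤n

      moves : ∀ s → Agrees s (plan ⊕ ρ) → Good (settle (plan ⊕ ρ) s) → Good (settle plan s)
      -- The isolating set consists of the clusters that meet the component of `source`. As `good?`
      -- makes the goal stable, membership may be taken as decided under a double negation, for all
      -- of the finitely many clusters at once.
      moves s agrees g = decidable-stable (good? t) λ ¬good →
        sequence (RawMonad.rawApplicative ¬¬-Monad)
                 (λ w → ¬¬-excluded-middle {A = ∃[ i ] Reach G r C source (w , i)})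
          λ dec → ¬good (move cv u₁ (cv≢NONE , forced-adj hit₁ , u₁≢ALL , S dec , isolates dec)
                                    (Good-mono below g))
        where
        t = settle plan s
        marked : ∀ {u c} → plan u ≡ nothing → ρ u ≡ just c → s u ≡ c
        marked {u} {c} eq ρu = agrees u c (trans (⊕-right plan ρ eq) ρu)
        cv≢NONE : t cv ≢ NONE
        cv≢NONE tcv with plan cv in eq | ρ-forcer
        ... | nothing | c , ρc , c≢NONE = c≢NONE (trans (sym (marked eq ρc)) tcv)
        u₁≢ALL : t u₁ ≢ ALL
        u₁≢ALL tu with trans (sym (trans (settle-nothing plan s open₁) (marked open₁ ρ-target))) tu
        ... | ()
        S : (∀ w → Dec (∃[ i ] Reach G r C source (w , i))) → Fin n → Bool
        S dec w = ⌊ dec w ⌋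
        isolates : ∀ dec → Isolates t cv u₁ (S dec)
        isolates dec = in-S (proj₁ hit₁ , proj₂ (forced⇒nbr (proj₁ (proj₂ hit₁)) (proj₂ (proj₂ hit₁))))
          , (λ x y x∈ xy ty → let i , p = out-S x∈ in in-S (open-reach {s} p xy ty))
          -- Any other neighbour of the forcer in this set that is not ALL is unplanned and forced
          -- in this step, so `ρ` would have marked it ALL.
          , λ w w∈ a tw → decidable-stable (w ≟ u₁) λ w≢u₁ →
              let i , p = out-S w∈
                  eq    = settle-open plan s tw
              in tw (trans (settle-nothing plan s eq)
                      (marked eq (ρ-hit w≢u₁ (i , reach-white p , nbr⇒blue (a , p)))))
          where
          in-S : ∀ {w} → ∃[ i ] Reach G r C source (w , i) → S dec w ≡ true
          in-S {w} p with dec w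
          ... | yes _ = refl
          ... | no ¬p = contradiction p ¬p
          out-S : ∀ {w} → S dec w ≡ true → ∃[ i ] Reach G r C source (w , i)
          out-S {w} eq with dec w
          ... | yes p = p
        below : ∀ w → settle (plan ⊕ ρ) s w ⊑ capture t cv u₁ w
        below w = capture-elim (settle (plan ⊕ ρ) s w ⊑_) {t} {cv} {u₁} w ⊑ALL λ w≢u₁ w≢cv →
          settle-⊕ plan ρ s (λ d ρw πw → case ρ-new ρw of λ where
            (inj₁ w≡u₁)        → contradiction w≡u₁ w≢u₁
            (inj₂ (inj₁ w≡cv)) → contradiction w≡cv w≢cv
            (inj₂ (inj₂ ρALL)) → marked πw ρALL) (⊑-refl _)

    simulate-force : Simulation B (just v) C′
    simulate-force with any? fresh?
    ... | yes (u₁ , fresh) = simulate-fresh u₁ fresh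
    ... | no stale         = simulate-stale stale

  simulate : ∀ {B m C} → Proc G r B m C → Simulation B m C
  simulate start         = simulate-start _
  simulate (force v p F) = simulate-force (simulate p) F
  simulate (back v p _)  = simulate-back (simulate p)

  -- In the final coloring no cluster has a white vertex, so by `hole` the plan is total. Its
  -- settled state is ALL everywhere, hence won, and `strategy` carries this back to the marking.
  compress : ∀ {B} → IsForcingSet G r B → ∃[ s ] (Good s × ∑ (price r ∘ s) ≤ count G r B)
  compress {B} (m , C , p , allBlue) = s , strategy s agrees (done settled)
    , ≤-trans (∑-mono λ u → ≤-reflexive (paid u)) cost
    where
    open Simulation (simulate p)
    s : State
    -- The default ALL is never taken, by `planned`.
    s u = fromMaybe ALL (plan u)
    agrees : Agrees s plan
    agrees u c eq rewrite eq = refl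
    planned : ∀ u → plan u ≢ nothing
    planned u eq with hole u eq
    ... | i , w = white-blue-⊥ w (allBlue (u , i))
    settled : ∀ u → settle plan s u ≡ ALL
    settled u with plan u in eq
    ... | just _  = refl
    ... | nothing = contradiction eq (planned u)
    paid : ∀ u → price r (s u) ≡ bill B plan u
    paid u with plan u in eq
    ... | just _  = refl
    ... | nothing = contradiction eq (planned u)

  -- The coloring given by a cheapest marking.

  module _ (2≤r : 2 ≤ r) (s : State) (good : Good s)
           (least : ∀ t → Good t → ∑ (price r ∘ s) ≤ ∑ (price r ∘ t)) where

    -- `first` is the blue vertex of a ONE cluster, and `second` shows that such a cluster is not
    -- entirely blue.
    first second : Fin r
    first  = fromℕ< (≤-trans (s≤s z≤n) 2≤r)
    second = fromℕ< 2≤r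

    second≢first : second ≢ first
    second≢first eq with trans (sym (toℕ-fromℕ< 2≤r)) (trans (cong toℕ eq) (toℕ-fromℕ< _))
    ... | ()

    shade : Mark → Fin r → Bool
    shade ALL  _ = true
    shade ONE  i = ⌊ i ≟ first ⌋
    shade NONE _ = false

    initial : Coloring G r
    initial (u , i) = shade (s u) i

    shade-one : ∀ {i} → shade ONE i ≡ true → i ≡ first
    shade-one {i} b with i ≟ first
    ... | yes eq = eq

    initial-aon : IsAON G r initial
    initial-aon u with s u
    ... | ALL  = inj₁ λ _ → refl
    ... | ONE  = inj₂ (inj₁ (first , ≟-refl first , λ _ → shade-one))
    ... | NONE = inj₂ (inj₂ λ _ → refl)

    initial-realises : Realises initial s
    initial-realises = record { full = full₀ ; gap = gap₀ ; seed = seed₀ }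
      where
      full₀ : ∀ u → s u ≡ ALL → AllCluster G r initial u
      full₀ u eq i rewrite eq = refl
      gap₀ : ∀ u → s u ≢ ALL → ∃[ i ] White G r initial (u , i)
      gap₀ u su with s u
      ... | ALL  = contradiction refl su
      ... | ONE  = second , ≟-≢ second≢first
      ... | NONE = first , refl
      seed₀ : ∀ u → s u ≢ NONE → ∃[ i ] Blue G r initial (u , i)
      seed₀ u su with s u
      ... | ALL  = first , refl
      ... | ONE  = first , ≟-refl first
      ... | NONE = contradiction refl su

    initial-count : count G r initial ≤ ∑ (price r ∘ s)
    initial-count = ∑-mono λ u → shade-count (s u)
      where
      shade-count : ∀ c → ∑ (λ i → indicator (shade c i)) ≤ price r c
      shade-count ALL  = ≤-reflexive ∑-1
      shade-count ONE  = sum-indicator≤ (shade ONE) (first ∷ []) (Unique.allFin⁺ r) λ i _ b → here (shade-one b)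
      shade-count NONE = sum-indicator≤ (shade NONE) [] (Unique.allFin⁺ r) λ i _ ()

    initial-completes : Completes initial
    initial-completes = play good initial-realises start _

    -- Any forcing set compresses to a good marking of no larger price, and the chosen marking is a
    -- cheapest one.
    initial-minimum : IsAONMinForcingSet G r initial
    initial-minimum =
      ((let m , C , p , allBlue , _ = initial-completes in m , C , p , allBlue)
      , λ B forcing → let t , g , t≤B = compress forcing in
          ≤-trans initial-count (≤-trans (least t g) t≤B))
      , initial-aon

theorem2p6 : ∀ {n} (G : SimpleGraph n) (r : ℕ) → 2 ≤ r →
    (∃[ B ] IsAONMinForcingSet G r B)
    × (3 ≤ r → ∀ B → IsAONMinForcingSet G r B →
    ∀ {m C} (p : Proc G r B m C) → EachStepOneCluster G r p)
    × (r ≡ 2 → ∃[ B ] (IsAONMinForcingSet G r B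
    × ∃[ m ] ∃[ C ] ∃[ p ] (AllBlue G r C × EachStepOneCluster G r {B} {m} {C} p)))
theorem2p6 G r 2≤r with Game.cheapest G r
... | s , good , least =
  (initial 2≤r s good least , initial-minimum 2≤r s good least)
  , (λ 3≤r B (_ , aon) p → proj₂ (tame-process 3≤r aon p))
  , λ _ → initial 2≤r s good least , initial-minimum 2≤r s good least , initial-completes 2≤r s good least
  where open Blowup G r
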